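{- Let $x=(x_1,x_2,\dots,x_n)$ be a binary sequence of length $n>19$ with $x_1=1$ whose first $19$ elements have run length encoding $(3,3,6,3,2,2)$; that is, $x_1=x_2=x_3=1$, $x_4=x_5=x_6=-1$, $x_7=\dots=x_{12}=1$, $x_{13}=x_{14}=x_{15}=-1$, $x_{16}=x_{17}=1$, $x_{18}=x_{19}=-1$. Put $p=3$, $t=9$, and $z_j=x_{p(j-1)+1}$, so that $z=(1,-1,1,1,-1,1,-1,\dots)$. Then $x_i=1$ for $1\le i\le p$, $x_{p+1}=-1$, and $x$ satisfies equation $(k)$ for all $1\le k\le t=9$, but $z$ does not satisfy equation $(k)$ for $k=3$, although $3\le \frac{t}{p}$. Consequently the following assertion is false: "if a binary sequence $x$ satisfies equation $(k)$ for $1\le k\le t$, and $x_i=1$ for $1\le i\le p$, $x_{p+1}=-1$ with $p>1$, then the sequence $z_j=x_{p(j-1)+1}$ satisfies equation $(k)$ for all $1\le k\le \frac{t}{p}$."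
   Context: A binary sequence of length $n$ is $x=(x_1,\dots,x_n)$ with each $x_i\in\{ -1,1\}$. For $1\le k<\frac{n-1}{2}$, the sequence $x$ is said to satisfy equation $(k)$ if $$\frac{1+(-1)^{k+1}}{2}=\sum_{i=1}^{k}(-1)^{i+1}x_i x_{2k+2-i}.$$ Whether equation $(k)$ holds depends only on the first $2k+1$ elements of the sequence, so for the sequence $z$ the equation $(k)$ is to be read as this identity with $z_1,\dots,z_{2k+1}$ in place of $x_1,\dots,x_{2k+1}$. The run length encoding of a finite sequence is the list of the lengths of its successive maximal blocks of equal consecutive elements. -}

module Defs where

open import Algebra.Definitions.RawMonoid using (sum)
open import Data.Fin.Base using (Fin; toℕ; fromℕ<; inject≤; opposite)
open import Data.Integer.Base as ℤ using (ℤ; 1ℤ; -1ℤ)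
import Data.Integer.DivMod as ℤ
open import Data.List.Base using (List; []; _∷_)
open import Data.Nat.Base
  using (ℕ; suc; pred; _+_; _*_; _/_; _≤_; _<_; NonZero)
open import Data.Nat.DivMod using (m/n*n≤m; m*n/n≡m; /-monoˡ-≤)
open import Data.Nat.Properties hiding (_≟_)
open import Data.Fin.Properties using (toℕ<n)
open import Data.Product.Base using (_×_; Σ-syntax)
open import Data.Sign.Base as Sign using (Sign)
open import Data.Sign.Properties using (_≟_)
open import Data.Vec.Functional using (Vector)
open import Relation.Binary.PropositionalEquality using (_≡_; cong)
open import Relation.Nullary.Decidable.Core using (yes; no)

-- The entry xᵢ (1 ≤ i ≤ n) is stored at the index whose toℕ is i - 1.
BinarySequence : ℕ → Set
BinarySequence n = Vector Sign n

⟦_⟧ : Sign → ℤ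
⟦ Sign.+ ⟧ = 1ℤ
⟦ Sign.- ⟧ = -1ℤ

prefix : ∀ {m n} → .(m ≤ n) → BinarySequence n → BinarySequence m
prefix m≤n x i = x (inject≤ i m≤n)

-- Equation (k), as a condition on x₁, …, x₂ₖ₊₁.  The index i : Fin k stands for
-- toℕ i + 1 in the 1-based sum, so the sign is (-1)^(toℕ i + 2).  In
-- Fin (2k + 1), opposite sends toℕ i to 2k - toℕ i, which in 1-based terms
-- sends i to 2k + 2 - i.
-- The integer division by 2 is exact: its numerator is 0 or 2.
Equation : (k : ℕ) → BinarySequence (suc (2 * k)) → Set
Equation k x =
  (1ℤ ℤ.+ -1ℤ ℤ.^ (k + 1)) ℤ./ℕ 2
    ≡ sum ℤ.+-0-rawMonoid (λ (i : Fin k) →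
        (-1ℤ ℤ.^ (toℕ i + 2)) ℤ.* (⟦ x (at i) ⟧ ℤ.* ⟦ x (opposite (at i)) ⟧))
  where
  at : Fin k → Fin (suc (2 * k))
  at i = inject≤ i (m≤n⇒m≤1+n (m≤m+n k _))

-- The second component is k < (n - 1) / 2.
Satisfies : ∀ {n} → BinarySequence n → ℕ → Set
Satisfies {n} x k =
  1 ≤ k × Σ[ 2k+1<n ∈ suc (2 * k) < n ] Equation k (prefix (<⇒≤ 2k+1<n) x)

-- run s c ss: the run lengths of ss preceded by c copies of s.
run : Sign → ℕ → List Sign → List ℕ
run s c []        = c ∷ []
run s c (s′ ∷ ss) with s ≟ s′
... | yes _ = run s (suc c) ss
... | no  _ = c ∷ run s′ 1 ss

runLengths : List Sign → List ℕ
runLengths []       = []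
runLengths (s ∷ ss) = run s 1 ss

-- xᵢ = 1 for 1 ≤ i ≤ p, and xₚ₊₁ exists and equals -1.
FirstRun : ∀ {n} → BinarySequence n → ℕ → Set
FirstRun {n} x p =
  (∀ (i : Fin n) → toℕ i < p → x i ≡ Sign.+) ×
  Σ[ p<n ∈ p < n ] x (fromℕ< p<n) ≡ Sign.-

-- ⌈ n / p ⌉, the number of j ≥ 1 with p (j - 1) + 1 ≤ n.
decimatedLength : (p : ℕ) .{{_ : NonZero p}} → ℕ → ℕ
decimatedLength p n = (n + pred p) / p

decimated-index : ∀ p .{{_ : NonZero p}} n j → j < decimatedLength p n → p * j < n
decimated-index p@(suc q) n j j<l = +-cancelʳ-≤ q (suc (p * j)) n (begin
  suc (p * j) + q    ≡⟨ +-comm (suc (p * j)) q ⟩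
  q + suc (p * j)    ≡⟨ +-suc q (p * j) ⟩
  p + p * j          ≡⟨ *-suc p j ⟨
  p * suc j          ≡⟨ *-comm p (suc j) ⟩
  suc j * p          ≤⟨ *-monoˡ-≤ p j<l ⟩
  (n + q) / p * p    ≤⟨ m/n*n≤m (n + q) p ⟩
  n + q              ∎)
  where open ≤-Reasoning

-- zⱼ = x₍ₚ₍ⱼ₋₁₎₊₁₎ for every j for which this entry exists; in 0-based terms,
-- index j of z is index p * j of x.
decimate : (p : ℕ) .{{_ : NonZero p}} → ∀ {n} →
           BinarySequence n → BinarySequence (decimatedLength p n)
decimate p {n} x j = x (fromℕ< (decimated-index p n (toℕ j) (toℕ<n j)))

decimatedLength-covers : ∀ p .{{_ : NonZero p}} n t k → suc (2 * t) < n →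
                         k ≤ t / p → suc (2 * k) ≤ decimatedLength p n
decimatedLength-covers p@(suc q) n t k 2t+1<n k≤t/p = begin
  suc (2 * k)                ≡⟨ m*n/n≡m (suc (2 * k)) p ⟨
  suc (2 * k) * p / p        ≤⟨ /-monoˡ-≤ p bound ⟩
  (n + q) / p                ∎
  where
  open ≤-Reasoning
  bound : suc (2 * k) * p ≤ n + q
  bound = begin
    p + 2 * k * p            ≡⟨ cong (p +_) (*-assoc 2 k p) ⟩
    p + 2 * (k * p)          ≤⟨ +-monoʳ-≤ p (*-monoʳ-≤ 2 (*-monoˡ-≤ p k≤t/p)) ⟩
    p + 2 * (t / p * p)      ≤⟨ +-monoʳ-≤ p (*-monoʳ-≤ 2 (m/n*n≤m t p)) ⟩
    p + 2 * t                ≡⟨ +-suc q (2 * t) ⟨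
    q + suc (2 * t)          ≤⟨ +-monoʳ-≤ q (<⇒≤ 2t+1<n) ⟩
    q + n                    ≡⟨ +-comm q n ⟩
    n + q                    ∎

-- The bound 2t + 1 < n says that all the equations (k) with 1 ≤ k ≤ t are in
-- the range k < (n - 1) / 2.  As k is a natural number, k ≤ t / p means the
-- same with the floor of t / p.
DecimationAssertion : Set
DecimationAssertion =
  ∀ {n} (x : BinarySequence n) (t p : ℕ) .{{_ : NonZero p}}
  (2t+1<n : suc (2 * t) < n) →
  (∀ k → 1 ≤ k → k ≤ t → Satisfies x k) →
  FirstRun x p →
  1 < p →
  ∀ k → 1 ≤ k → (k≤t/p : k ≤ t / p) →
  Equation k (prefix (decimatedLength-covers p n t k 2t+1<n k≤t/p) (decimate p x))

{-# OPTIONS --safe #-}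
-- A run length encoding and the first sign determine a finite sequence, so the
-- first 19 entries of x are one explicit sequence w.  Equations (1), …, (9) and
-- the first seven entries of the decimation by 3 see only w, which reduces
-- everything to evaluation; at k = 3 the decimation gives
-- z₁z₇ - z₂z₆ + z₃z₅ = -1 ≠ 1.
module Submission where

open import Defs
open import Data.List.Base using ([]; _∷_; _++_; replicate)
open import Data.Fin.Base using (zero)
open import Data.Nat.Base using (_<_; _≤_; _/_)
open import Data.Nat.Properties using (<⇒≤)
open import Data.Product.Base using (_×_; Σ-syntax)
open import Data.Sign.Base as Sign using ()
open import Data.Vec.Functional using (toList)
open import Relation.Binary.PropositionalEquality using (_≡_)
open import Relation.Nullary.Negation.Core using (¬_)

open import Algebra.Properties.Monoid.Sum using (sum-cong-≗)
open import Data.Fin.Base using (Fin; suc; toℕ; fromℕ<; inject≤)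
open import Data.Fin.Properties
  using (all?; toℕ-fromℕ<; toℕ-inject≤; toℕ-injective; toℕ<n)
open import Data.Integer.Base as ℤ using (-1ℤ)
import Data.Integer.Properties as ℤ
open import Data.List.Base using (List; lookup)
open import Data.List.Properties using (∷-injectiveˡ; ∷-injectiveʳ; tabulate-cong)
open import Data.Nat.Base using (ℕ; zero; suc; _+_; _*_; NonZero; s≤s; z≤n)
open import Data.Nat.DivMod using (/-monoˡ-≤)
open import Data.Nat.Properties
  using (_<?_; <-trans; ≤-<-trans; <-≤-trans; ≤-refl; +-monoˡ-≤; *-monoʳ-≤)
open import Data.Product.Base using (_,_)
open import Data.Sign.Base using (Sign)
open import Data.Sign.Properties using (_≟_)
open import Function.Base using (_∘_)
open import Relation.Binary.PropositionalEquality
  using (_≗_; refl; sym; trans; cong; cong₂; subst; module ≡-Reasoning)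
open import Relation.Nullary.Decidable using (toWitness; _→-dec_)

-- Inverse of the run length encoding: neighbouring runs have opposite signs, so the first sign and
-- the lengths suffice.
expand : Sign → List ℕ → List Sign
expand s []       = []
expand s (c ∷ cs) = replicate c s ++ expand (Sign.opposite s) cs

replicate-++-∷ : ∀ {A : Set} c (a : A) as →
                 replicate c a ++ a ∷ as ≡ a ∷ replicate c a ++ as
replicate-++-∷ zero    a as = refl
replicate-++-∷ (suc c) a as = cong (a ∷_) (replicate-++-∷ c a as)

-- Induction on `ss` with the counter `c` left general: an equal sign joins the open run, the
-- opposite sign closes it and starts a run with counter 1. Matching on concrete signs lets the test
-- inside `run` compute.
expand-run : ∀ s c ss → expand s (run s c ss) ≡ replicate c s ++ ss
expand-run s      c []            = refl
expand-run Sign.+ c (Sign.+ ∷ ss) =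
  trans (expand-run Sign.+ (suc c) ss) (sym (replicate-++-∷ c Sign.+ ss))
expand-run Sign.- c (Sign.- ∷ ss) =
  trans (expand-run Sign.- (suc c) ss) (sym (replicate-++-∷ c Sign.- ss))
expand-run Sign.+ c (Sign.- ∷ ss) =
  cong (replicate c Sign.+ ++_) (expand-run Sign.- 1 ss)
expand-run Sign.- c (Sign.+ ∷ ss) =
  cong (replicate c Sign.- ++_) (expand-run Sign.+ 1 ss)

toList-from-runLengths : ∀ {n} (x : BinarySequence (suc n)) {s cs} →
  x zero ≡ s → runLengths (toList x) ≡ cs → toList x ≡ expand s cs
toList-from-runLengths x refl refl = sym (expand-run (x zero) 1 (toList (x ∘ suc)))

toList-injective : ∀ {A : Set} {n} {f g : Fin n → A} → toList f ≡ toList g → f ≗ g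
toList-injective eq zero    = ∷-injectiveˡ eq
toList-injective eq (suc i) = toList-injective (∷-injectiveʳ eq) i

-- Pointwise agreement does not yield `x ≡ y` without function extensionality, so it is carried
-- through the sum term by term.
Equation-cong : ∀ k {x y} → x ≗ y → Equation k x → Equation k y
Equation-cong k x≗y eq = trans eq (sum-cong-≗ ℤ.+-0-monoid {k} λ i →
  cong ((-1ℤ ℤ.^ (toℕ i + 2)) ℤ.*_)
    (cong₂ (λ a b → ⟦ a ⟧ ℤ.* ⟦ b ⟧) (x≗y _) (x≗y _)))

module _ {m n} (m≤n : m ≤ n) (x : BinarySequence n) {w : BinarySequence m}
         (x≗w : prefix m≤n x ≗ w) where

  -- An index is determined by its `toℕ`, so every later comparison of `x` with `w` reduces to
  -- arithmetic on positions.
  prefix-agrees : ∀ i j → toℕ i ≡ toℕ j → x i ≡ w j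
  prefix-agrees i j i≡j = trans
    (cong x (toℕ-injective (trans i≡j (sym (toℕ-inject≤ j m≤n))))) (x≗w j)

  prefix-prefix : ∀ {l} .(l≤m : l ≤ m) .(l≤n : l ≤ n) →
                  prefix l≤n x ≗ prefix l≤m w
  prefix-prefix l≤m l≤n i = prefix-agrees _ _
    (trans (toℕ-inject≤ i l≤n) (sym (toℕ-inject≤ i l≤m)))

  -- Entry `j` of either decimation is read at position `p * j`.
  prefix-decimate : ∀ p .{{_ : NonZero p}}
                    .(l≤ : decimatedLength p m ≤ decimatedLength p n) →
                    prefix l≤ (decimate p x) ≗ decimate p w
  prefix-decimate p l≤ j = prefix-agrees _ _ (begin
    toℕ (fromℕ< _)           ≡⟨ toℕ-fromℕ< _ ⟩
    p * toℕ (inject≤ j l≤)   ≡⟨ cong (p *_) (toℕ-inject≤ j l≤) ⟩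
    p * toℕ j                ≡⟨ toℕ-fromℕ< _ ⟨
    toℕ (fromℕ< _)           ∎)
    where open ≡-Reasoning

  FirstRun-extend : ∀ {p} → FirstRun w p → FirstRun x p
  FirstRun-extend {p} (ones , p<m , minus) =
    (λ i i<p → let i≡ = toℕ-fromℕ< (<-trans i<p p<m) in
       trans (prefix-agrees i _ (sym i≡)) (ones _ (subst (_< p) (sym i≡) i<p))) ,
    <-≤-trans p<m m≤n ,
    trans (prefix-agrees _ _ (trans (toℕ-fromℕ< _) (sym (toℕ-fromℕ< p<m)))) minus

decimatedLength-mono : ∀ p .{{_ : NonZero p}} {m n} → m ≤ n →
                       decimatedLength p m ≤ decimatedLength p n
decimatedLength-mono p m≤n = /-monoˡ-≤ p (+-monoˡ-≤ _ m≤n)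

signs : List Sign
signs = expand Sign.+ (3 ∷ 3 ∷ 6 ∷ 3 ∷ 2 ∷ 2 ∷ [])

w : BinarySequence 19
w = lookup signs

FirstRun-w : FirstRun w 3
FirstRun-w =
  toWitness {a? = all? λ i → (toℕ i <? 3) →-dec (w i ≟ Sign.+)} _ ,
  toWitness {a? = 3 <? 19} _ , refl

2k+1≤19 : ∀ {k} → k ≤ 9 → suc (2 * k) ≤ 19
2k+1≤19 k≤9 = s≤s (*-monoʳ-≤ 2 k≤9)

Equation-w : ∀ {k} → 1 ≤ k → (k≤9 : k ≤ 9) → Equation k (prefix (2k+1≤19 k≤9) w)
Equation-w {suc k} (s≤s z≤n) k<9 = go (fromℕ< k<9) (toℕ-fromℕ< k<9) k<9
  where
  instances : ∀ (i : Fin 9) → Equation (suc (toℕ i)) (prefix (2k+1≤19 (toℕ<n i)) w)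
  -- All nine equations are closed integer identities, settled by evaluating the decision procedure.
  instances = toWitness {a? = all? λ i → _ ℤ.≟ _} _

  -- With `k` general, `refl` can replace it by `toℕ i`; the two bounds may differ because `prefix`
  -- takes its bound irrelevantly.
  go : ∀ {k} (i : Fin 9) → toℕ i ≡ k → (k<9 : k < 9) →
       Equation (suc k) (prefix (2k+1≤19 k<9) w)
  go i refl _ = instances i

-- `decimatedLength 3 19` evaluates to 7, the length that equation (3) reads, and the two sides
-- evaluate to distinct integers.
¬Equation-decimate-w : ¬ Equation 3 (decimate 3 w)
¬Equation-decimate-w ()

module _ {n} (19<n : 19 < n) (x : BinarySequence n)
         (x≗w : prefix (<⇒≤ 19<n) x ≗ w) where

  Satisfies-extend : ∀ k → 1 ≤ k → k ≤ 9 → Satisfies x k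
  -- At `k = 9` all 19 entries are read, so the strictness of 19 < n keeps this equation in range.
  Satisfies-extend k 1≤k k≤9 = 1≤k , ≤-<-trans (2k+1≤19 k≤9) 19<n ,
    Equation-cong k (sym ∘ prefix-prefix (<⇒≤ 19<n) x x≗w (2k+1≤19 k≤9) _)
      (Equation-w 1≤k k≤9)

  ¬Equation-decimate : .(7≤l : 7 ≤ decimatedLength 3 n) →
                       ¬ Equation 3 (prefix 7≤l (decimate 3 x))
  ¬Equation-decimate 7≤l =
    ¬Equation-decimate-w ∘ Equation-cong 3 (prefix-decimate (<⇒≤ 19<n) x x≗w 3 7≤l)

¬DecimationAssertion : ¬ DecimationAssertion
¬DecimationAssertion assertion =
  ¬Equation-decimate 19<20 x x≗w (decimatedLength-mono 3 (<⇒≤ 19<20))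
    -- Here t = 9, p = 3 and k = 3 = t / p; `19<20` also serves as 2t + 1 < n.
    (assertion x 9 3 19<20 (Satisfies-extend 19<20 x x≗w)
      (FirstRun-extend (<⇒≤ 19<20) x x≗w FirstRun-w)
      (s≤s (s≤s z≤n)) 3 (s≤s z≤n) ≤-refl)
  where
  19<20 : 19 < 20
  19<20 = ≤-refl

  x : BinarySequence 20
  -- Length 20 is the least allowed; either sign could be appended.
  x = lookup (signs ++ Sign.+ ∷ [])

  x≗w : prefix (<⇒≤ 19<20) x ≗ w
  x≗w = toList-injective refl

mainTheorem1 : (∀ n (x : BinarySequence n) (19<n : 19 < n) →
    prefix (<⇒≤ 19<n) x (zero {18}) ≡ Sign.+ →
    runLengths (toList (prefix (<⇒≤ 19<n) x)) ≡ 3 ∷ 3 ∷ 6 ∷ 3 ∷ 2 ∷ 2 ∷ [] →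
    toList (prefix (<⇒≤ 19<n) x) ≡
    replicate 3 Sign.+ ++ replicate 3 Sign.- ++ replicate 6 Sign.+ ++
    replicate 3 Sign.- ++ replicate 2 Sign.+ ++ replicate 2 Sign.-
    × FirstRun x 3
    × (∀ k → 1 ≤ k → k ≤ 9 → Satisfies x k)
    × 3 ≤ 9 / 3
    × Σ[ 7≤l ∈ 7 ≤ decimatedLength 3 n ]
    ( toList (prefix 7≤l (decimate 3 x)) ≡
    Sign.+ ∷ Sign.- ∷ Sign.+ ∷ Sign.+ ∷ Sign.- ∷ Sign.+ ∷ Sign.- ∷ []
    × ¬ Equation 3 (prefix 7≤l (decimate 3 x)) ))
    × ¬ DecimationAssertion
mainTheorem1 =
  (λ n x 19<n x₁≡+ runs →
    let 19≤n = <⇒≤ 19<n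
        x≡   = toList-from-runLengths (prefix 19≤n x) x₁≡+ runs
        -- The expanded run lengths are `toList w` by evaluation.
        x≗w  = toList-injective {g = w} x≡
        7≤l  = decimatedLength-mono 3 19≤n
    in x≡ , FirstRun-extend 19≤n x x≗w FirstRun-w , Satisfies-extend 19<n x x≗w ,
       ≤-refl , 7≤l ,
       tabulate-cong (prefix-decimate 19≤n x x≗w 3 7≤l) ,
       ¬Equation-decimate 19<n x x≗w 7≤l) ,
  ¬DecimationAssertion
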